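{- Let $G$ be a connected graph of genus $g$. Then there are an integer $c=O(\log g)$, co-bipartite graphs $G_1,\dots,G_c$, a unit interval graph $G_{c+1}$, and a chordal graph $G_{c+2}$ such that $G=\bigcap_{i=1}^{c+2}G_i$. Here $c=O(\log g)$ means that there is a function $c(g)$ of $g$ alone, with $c(g)=O(\log g)$ as $g\to\infty$, such that for every $g$ and every connected graph $G$ of genus $g$ the representation exists with $c=c(g)$.
   Context: Graphs are finite, simple and undirected. $G=\bigcap_{i=1}^d G_i$ means that $V(G_i)=V(G)$ for all $i$ and $E(G)=\bigcap_{i=1}^d E(G_i)$. The genus of a graph is the smallest $g$ such that the graph can be embedded without crossings in the orientable surface of genus $g$. A co-bipartite graph is the complement of a bipartite graph. A unit interval graph is the intersection graph of a family of unit-length intervals on the real line (vertices correspond to intervals, two distinct vertices being adjacent iff their intervals intersect). A graph is chordal if it has no induced (chordless) cycle of length at least four. -}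

module Defs where

open import Data.Bool using (Bool; not)
open import Data.Fin using (Fin; toℕ)
open import Data.Nat using (ℕ; suc; _+_; _*_; _≤_)
open import Data.Nat.GeneralisedArithmetic using (fold)
import Data.Fin.Properties as Fin
import Data.Rational as ℚ
open import Data.Rational using (ℚ; 1ℚ)
open import Data.Product using (_×_; _,_; ∃₂; ∃-syntax; Σ-syntax)
open import Data.Sum using (_⊎_)
open import Function.Base using (_∘_)
open import Function.Bundles using (_⇔_; _↔_; Inverse)
open import Function.Definitions using (Injective; Surjective)
open import Level using (0ℓ)
open import Relation.Binary using (Rel; Symmetric; Irreflexive; Decidable)
open import Relation.Binary.Construct.Closure.ReflexiveTransitive using (Star)
open import Relation.Binary.PropositionalEquality using (_≡_; _≢_; sym)
open import Relation.Nullary using (¬_)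
open import Relation.Nullary.Decidable using (_×-dec_; ¬?)

------------------------------------------------------------------------
-- Graphs

record Graph (n : ℕ) : Set₁ where
  field
    Adj         : Rel (Fin n) 0ℓ
    symmetric   : Symmetric Adj
    irreflexive : Irreflexive _≡_ Adj
    decidable   : Decidable Adj

open Graph public using (Adj)

-- The empty graph counts as connected under this definition.
Connected : ∀ {n} → Graph n → Set
Connected G = ∀ u v → Star (Adj G) u v

_HasSameEdgesAs_ : ∀ {n} → Graph n → Graph n → Set
G HasSameEdgesAs H = ∀ u v → Adj G u v ⇔ Adj H u v

complement : ∀ {n} → Graph n → Graph n
complement G = record
  { Adj         = λ u v → u ≢ v × ¬ Adj G u v
  ; symmetric   = λ (u≢v , ¬uv) → u≢v ∘ sym , ¬uv ∘ Graph.symmetric G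
  ; irreflexive = λ u≡v (u≢v , _) → u≢v u≡v
  ; decidable   = λ u v → ¬? (u Fin.≟ v) ×-dec ¬? (Graph.decidable G u v)
  }

_IsIntersectionOf_ : ∀ {n d} → Graph n → (Fin d → Graph n) → Set
G IsIntersectionOf H = ∀ u v → Adj G u v ⇔ (∀ i → Adj (H i) u v)

------------------------------------------------------------------------
-- Graph classes

Bipartite : ∀ {n} → Graph n → Set
Bipartite {n} G =
  Σ[ side ∈ (Fin n → Bool) ] (∀ u v → Adj G u v → side u ≢ side v)

CoBipartite : ∀ {n} → Graph n → Set₁
CoBipartite {n} G =
  Σ[ B ∈ Graph n ] Bipartite B × G HasSameEdgesAs complement B

-- t lies in the closed interval [x, x + 1].
_∈[_,+1] : ℚ → ℚ → Set
t ∈[ x ,+1] = x ℚ.≤ t × t ℚ.≤ x ℚ.+ 1ℚ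

-- Rational intervals represent exactly the same finite graphs as real ones.
UnitInterval : ∀ {n} → Graph n → Set
UnitInterval {n} G = Σ[ start ∈ (Fin n → ℚ) ] (∀ u v →
  Adj G u v ⇔ (u ≢ v × ∃[ t ] (t ∈[ start u ,+1] × t ∈[ start v ,+1])))

CyclicSucc : ∀ {k} → Rel (Fin k) 0ℓ
CyclicSucc {k} i j =
  suc (toℕ i) ≡ toℕ j ⊎ (suc (toℕ i) ≡ k × toℕ j ≡ 0)

InducedCycle : ∀ {n} → Graph n → ℕ → Set
InducedCycle {n} G k = Σ[ c ∈ (Fin k → Fin n) ] Injective _≡_ _≡_ c ×
  (∀ i j → Adj G (c i) (c j) ⇔ (CyclicSucc i j ⊎ CyclicSucc j i))

Chordal : ∀ {n} → Graph n → Set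
Chordal G = ∀ k → 4 ≤ k → ¬ InducedCycle G k

------------------------------------------------------------------------
-- Surfaces and genus

-- An edge together with one of its two orientations.
Dart : ℕ → Set
Dart e = Fin e × Bool

reverse : ∀ {e} → Dart e → Dart e
reverse (i , b) = i , not b

SameOrbit : ∀ {A : Set} → (A → A) → Rel A 0ℓ
SameOrbit f x y = ∃[ k ] fold x f k ≡ y

-- `class` numbers the orbits of f as 0, …, m - 1, each number being used.
IsOrbitNumbering : ∀ {A : Set} {m} → (A → A) → (A → Fin m) → Set
IsOrbitNumbering f class =
  Surjective _≡_ _≡_ class × (∀ x y → class x ≡ class y ⇔ SameOrbit f x y)

-- A decomposition into cells of the closed connected orientable surface of
-- genus g, as a combinatorial map: `rotation` sends a dart to the next one
-- in the anticlockwise order around its origin.  Following a dart to its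
-- head and turning to the next dart there traces the boundary of a face, so
-- vertices and faces are the orbits of `rotation` and `rotation ∘ reverse`.
-- Loops and parallel edges are allowed.  There is at least one edge, so every
-- vertex and face is seen by some dart; the sphere decomposed into a point
-- and a disc is excluded, which does not affect embeddability below.
record CellDecomposition (g : ℕ) : Set where
  field
    #V #E #F : ℕ
    rotation : Dart #E ↔ Dart #E

  rotate : Dart #E → Dart #E
  rotate = Inverse.to rotation

  field
    origin       : Dart #E → Fin #V
    face         : Dart #E → Fin #F
    origin-orbit : IsOrbitNumbering rotate origin
    face-orbit   : IsOrbitNumbering (rotate ∘ reverse) face

  Joins : Dart #E → Rel (Fin #V) 0ℓ
  Joins d u v = origin d ≡ u × origin (reverse d) ≡ v

  field
    nonempty  : 1 ≤ #E
    connected : ∀ u v → Star (λ x y → ∃[ d ] Joins d x y) u v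
    euler     : #V + #F + 2 * g ≡ #E + 2

-- A crossing-free drawing in a surface can be completed to a cell
-- decomposition by adding vertices and edges, so embedding G means finding it
-- as a subgraph of the 1-skeleton of some decomposition.  The faces of G
-- itself need not be discs.
record _EmbedsInGenus_ {n} (G : Graph n) (g : ℕ) : Set where
  field
    surface   : CellDecomposition g
  open CellDecomposition surface
  field
    vertex    : Fin n → Fin #V
    injective : Injective _≡_ _≡_ vertex
    edge      : ∀ u v → Adj G u v → ∃[ d ] Joins d (vertex u) (vertex v)

_HasGenus_ : ∀ {n} → Graph n → ℕ → Set
G HasGenus g = G EmbedsInGenus g × (∀ h → G EmbedsInGenus h → g ≤ h)

------------------------------------------------------------------------
-- Asymptotics

_=O_ : (ℕ → ℕ) → (ℕ → ℕ) → Set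
f =O h = ∃₂ λ C N → ∀ m → N ≤ m → f m ≤ C * h m

{-# OPTIONS --safe #-}

-- Take a breadth-first spanning tree T of the 1-skeleton and a spanning tree D of
-- the dual graph that avoids T.  By Euler's formula at most 2g edges, the handles,
-- belong to neither.  Fan-triangulating the faces gives a tree of triangles, indexed
-- by darts; put into the bag of a triangle all T-ancestors of its three corners and
-- of the ends of the handles.  If no handle ends below v, walking around the subtree
-- of T below v shows that the bags containing v are connected, so this is a tree
-- decomposition, and each bag meets each level of T in at most 4g + 3 vertices.
-- Sharing a bag is a chordal graph and being on equal or consecutive levels is a unit
-- interval graph.  Their intersection contains G and has a proper colouring with O(g)
-- colours (greedy within a level, together with the parity of the level); the O(log g)
-- bits of the colour give co-bipartite graphs that exclude the remaining non-edges.

module Submission where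

open import Defs
open import Data.Bool as Bool using (Bool; true; false; not)
open import Data.Bool.Properties using (not-involutive; not-injective)
open import Data.Fin as Fin using (Fin; zero; suc; toℕ; fromℕ<; _↑ˡ_; _↑ʳ_; join; splitAt; combine; inject≤; finToFun; funToFin)
import Data.Fin.Properties as Fin
open import Data.List using (List; _∷_; lookup; filter; allFin; length)
open import Data.List.Membership.Propositional.Properties using (∈-lookup; ∈-filter⁺; ∈-filter⁻; ∈-allFin)
import Data.List.Relation.Unary.All as All
open import Data.List.Relation.Unary.AllPairs using (_∷_)
open import Data.List.Relation.Unary.Any using (index)
open import Data.List.Relation.Unary.Any.Properties using (lookup-index)
open import Data.List.Relation.Unary.Unique.Propositional using (Unique)
open import Data.List.Relation.Unary.Unique.Propositional.Properties using (allFin⁺; filter⁺)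
open import Data.Nat
open import Data.Nat.DivMod using (_%_; [m+kn]%n≡m%n; m<n⇒m%n≡m)
open import Data.Nat.GeneralisedArithmetic using (fold; iterate)
open import Data.Nat.Logarithm using (⌊log₂_⌋; ⌊log₂⌋-mono-≤; ⌊log₂[2^n]⌋≡n)
open import Data.Nat.Properties
open import Data.Nat.Solver using (module +-*-Solver)
open import Data.Product using (_×_; _,_; ∃; ∃-syntax; Σ-syntax; proj₁; proj₂)
open import Data.Product.Properties using (≡-dec)
open import Data.Rational as ℚ using (ℚ; 0ℚ; 1ℚ)
import Data.Rational.Properties as ℚ
open import Data.Sum using (_⊎_; inj₁; inj₂; [_,_]′; map₁)
open import Data.Sum.Properties using (inj₁-injective; inj₂-injective)
open import Data.Unit using (⊤; tt)
open import Function using (_∘_; id; Injective; Injection; Equivalence; Inverse; _⇔_; mk⇔)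
open import Function.Properties.Inverse using (↔⇒↣; ↔-sym)
open import Level using (0ℓ)
open import Relation.Binary using (Rel; Symmetric; IsEquivalence; tri<; tri≈; tri>)
import Relation.Binary.Construct.Closure.ReflexiveTransitive as Star
open Star using (Star; ε; _◅_; _◅◅_)
open import Relation.Binary.PropositionalEquality
open import Relation.Nullary using (¬_; Dec; yes; no; contradiction)
open import Relation.Nullary.Decidable using (map′; _×-dec_; _⊎-dec_; ¬?; decidable-stable)
open import Relation.Unary using (Decidable)

-- Finite search and elementary facts about darts.

least : ∀ {P : ℕ → Set} → Decidable P → ∀ k → P k → ∃[ m ] P m × (∀ j → P j → m ≤ j)
least P? zero p = zero , p , λ _ _ → z≤n
least P? (suc k) p with P? 0
... | yes p₀ = zero , p₀ , λ _ _ → z≤n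
... | no ¬p₀ with m , pₘ , min ← least (P? ∘ suc) k p =
  suc m , pₘ , λ { zero p₀ → contradiction p₀ ¬p₀ ; (suc j) pⱼ → s≤s (min j pⱼ) }

argmax : ∀ {n} (f : Fin (suc n) → ℕ) → ∃[ i ] ∀ j → f j ≤ f i
argmax {zero}  f = zero , λ { zero → ≤-refl }
argmax {suc n} f with argmax (f ∘ suc)
... | i , max with ≤-total (f zero) (f (suc i))
...   | inj₁ f₀≤ = suc i , λ { zero → f₀≤ ; (suc j) → max j }
...   | inj₂ ≤f₀ = zero  , λ { zero → ≤-refl ; (suc j) → ≤-trans (max j) ≤f₀ }

bounded : ∀ {n} (f : Fin n → ℕ) → ∃[ b ] ∀ i → f i ≤ b
bounded {zero}  f = 0 , λ ()
bounded {suc n} f with i , max ← argmax f = f i , max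

anyDart? : ∀ {e} {P : Dart e → Set} → Decidable P → Dec (∃ P)
anyDart? P? = map′
  (λ { (i , inj₁ p) → (i , true) , p ; (i , inj₂ p) → (i , false) , p })
  (λ { ((i , true) , p) → i , inj₁ p ; ((i , false) , p) → i , inj₂ p })
  (Fin.any? λ i → P? (i , true) ⊎-dec P? (i , false))

boundedᵈ : ∀ {e} (f : Dart e → ℕ) → ∃[ b ] ∀ d → f d ≤ b
boundedᵈ f with a , f≤a ← bounded (λ i → f (i , true))
             |  b , f≤b ← bounded (λ i → f (i , false)) =
  a ⊔ b , λ { (i , true)  → ≤-trans (f≤a i) (m≤m⊔n a b)
            ; (i , false) → ≤-trans (f≤b i) (m≤n⊔m a b) }

reverse-involutive : ∀ {e} (d : Dart e) → reverse (reverse d) ≡ d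
reverse-involutive (i , b) = cong (i ,_) (not-involutive b)

same-edge : ∀ {e} (d d′ : Dart e) → proj₁ d ≡ proj₁ d′ → d ≡ d′ ⊎ d ≡ reverse d′
same-edge (i , true)  (.i , true)  refl = inj₁ refl
same-edge (i , true)  (.i , false) refl = inj₂ refl
same-edge (i , false) (.i , true)  refl = inj₂ refl
same-edge (i , false) (.i , false) refl = inj₁ refl

lookup-injective : ∀ {A : Set} {xs : List A} → Unique xs → Injective _≡_ _≡_ (lookup xs)
lookup-injective {xs = _ ∷ xs} (x∉ ∷ u) {zero}  {zero}  eq = refl
lookup-injective {xs = _ ∷ xs} (x∉ ∷ u) {zero}  {suc j} eq =
  contradiction eq (All.lookup x∉ (∈-lookup {xs = xs} j))
lookup-injective {xs = _ ∷ xs} (x∉ ∷ u) {suc i} {zero}  eq =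
  contradiction (sym eq) (All.lookup x∉ (∈-lookup {xs = xs} i))
lookup-injective {xs = _ ∷ xs} (x∉ ∷ u) {suc i} {suc j} eq = cong suc (lookup-injective u eq)

-- Greedy colouring along a ranking.

module _ {n k} (A : Rel (Fin n) 0ℓ) (A-sym : Symmetric A)
         (rank : Fin n → ℕ) (back : Fin n → Fin k → Fin n)
         (covers : ∀ u v → A u v → rank u ≤ rank v → ∃[ i ] back v i ≡ u) where

  private
    fresh : (f : Fin k → Fin (suc k)) → ∃[ x ] ¬ (∃[ i ] f i ≡ x)
    fresh f = Fin.¬∀⟶∃¬ (suc k) _ (λ x → Fin.any? λ i → f i Fin.≟ x) λ onto →
      <⇒≱ (n<1+n k) (Fin.injective⇒≤ {f = proj₁ ∘ onto} λ {x} {y} eq →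
        trans (sym (proj₂ (onto x))) (trans (cong f eq) (proj₂ (onto y))))

    -- Lexicographic in rank and vertex number, so that vertices of equal rank are ordered as well.
    key : Fin n → ℕ
    key v = rank v * n + toℕ v

    key-injective : Injective _≡_ _≡_ key
    key-injective {u} {v} eq = Fin.toℕ-injective (begin
      toℕ u                       ≡⟨ key% u ⟨
      (key u % n) ⦃ nz ⦄          ≡⟨ cong (λ x → (x % n) ⦃ nz ⦄) eq ⟩
      (key v % n) ⦃ nz ⦄          ≡⟨ key% v ⟩
      toℕ v                       ∎)
      where
      open ≡-Reasoning
      nz : NonZero n
      nz = >-nonZero (≤-<-trans z≤n (Fin.toℕ<n u))
      key% : ∀ w → (key w % n) ⦃ nz ⦄ ≡ toℕ w
      key% w = trans (cong (λ x → (x % n) ⦃ nz ⦄) (+-comm (rank w * n) (toℕ w)))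
                     (trans ([m+kn]%n≡m%n (toℕ w) (rank w) n ⦃ nz ⦄)
                            (m<n⇒m%n≡m ⦃ nz ⦄ (Fin.toℕ<n w)))

    key<⇒rank≤ : ∀ {u v} → key u < key v → rank u ≤ rank v
    key<⇒rank≤ {u} {v} key< = ≮⇒≥ λ rank> → <⇒≱ key< (begin
      rank v * n + toℕ v ≤⟨ +-monoʳ-≤ (rank v * n) (<⇒≤ (Fin.toℕ<n v)) ⟩
      rank v * n + n     ≡⟨ +-comm (rank v * n) n ⟩
      suc (rank v) * n   ≤⟨ *-monoˡ-≤ n rank> ⟩
      rank u * n         ≤⟨ m≤m+n _ _ ⟩
      key u              ∎)
      where open ≤-Reasoning

    ProperBelow : ℕ → (Fin n → Fin (suc k)) → Set
    ProperBelow b col = ∀ u v → key u < key v → key v < b → A u v → col u ≢ col v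

    colour-below : ∀ b → ∃ (ProperBelow b)
    colour-below zero    = (λ _ → zero) , λ _ _ _ ()
    colour-below (suc b) with col , proper ← colour-below b = col′ , proper′
      where
      col′ : Fin n → Fin (suc k)
      col′ v with key v ≟ b
      ... | yes _ = proj₁ (fresh (col ∘ back v))
      ... | no _  = col v
      proper′ : ProperBelow (suc b) col′
      proper′ u v u<v v<1+b uv eq with key u ≟ b | key v ≟ b
      ... | yes u≡b | _       = <⇒≱ u<v (subst (key v ≤_) (sym u≡b) (s≤s⁻¹ v<1+b))
      ... | no _    | no v≢b  = proper u v u<v (≤∧≢⇒< (s≤s⁻¹ v<1+b) v≢b) uv eq
      -- Every neighbour of `v` with a smaller key occurs in `back v`, whose colours the fresh one
      -- avoids.
      ... | no _    | yes v≡b with i , refl ← covers u v uv (key<⇒rank≤ u<v) =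
        proj₂ (fresh (col ∘ back v)) (i , eq)

  -- When vertices are coloured in the order of `key`, each one has at most `k` earlier neighbours,
  -- so one of `k + 1` colours is still free.
  greedy-colouring : ∃[ col ] (∀ u v → u ≢ v → A u v → col u ≢ col v)
  greedy-colouring with b , key≤b ← bounded key
                   with col , proper ← colour-below (suc b) = col , all
    where
    all : ∀ u v → u ≢ v → A u v → col u ≢ col v
    all u v u≢v uv eq with <-cmp (key u) (key v)
    ... | tri< u<v _ _ = proper u v u<v (s≤s (key≤b v)) uv eq
    ... | tri≈ _ u≡v _ = u≢v (key-injective u≡v)
    ... | tri> _ _ v<u = proper v u v<u (s≤s (key≤b u)) (A-sym uv) (sym eq)

-- Chordality from rooted tree decompositions.

cyclic-succ : ∀ {k} (i : Fin k) → ∃[ j ] CyclicSucc i j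
cyclic-succ {suc k} i with suc (toℕ i) <? suc k
... | yes i<k = fromℕ< i<k , inj₁ (sym (Fin.toℕ-fromℕ< i<k))
... | no  i≮k = zero , inj₂ (≤-antisym (Fin.toℕ<n i) (≮⇒≥ i≮k) , refl)

cyclic-pred : ∀ {k} (i : Fin k) → ∃[ j ] CyclicSucc j i
cyclic-pred {suc k} zero    = Fin.fromℕ k , inj₂ (cong suc (Fin.toℕ-fromℕ k) , refl)
cyclic-pred {suc k} (suc i) = Fin.inject₁ i , inj₁ (cong suc (Fin.toℕ-inject₁ i))

-- This is where length at least four enters: the two neighbours `h` and `j` of `i` could coincide
-- on a cycle of length 2 and be consecutive on one of length 3.
cyclic-apart : ∀ {k} → 4 ≤ k → (h i j : Fin k) → CyclicSucc h i → CyclicSucc i j →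
               h ≢ j × ¬ CyclicSucc h j × ¬ CyclicSucc j h
cyclic-apart {k} 4≤k h i j hi ij =
  (λ { refl → no-2-cycle 4≤k hi ij }) , no-chord 4≤k hi ij , no-3-cycle 4≤k hi ij
  where
  Succ : ℕ → ℕ → ℕ → Set
  Succ k a b = suc a ≡ b ⊎ (suc a ≡ k × b ≡ 0)

  no-2-cycle : ∀ {k a b} → 4 ≤ k → Succ k a b → ¬ Succ k b a
  no-2-cycle {a = a} _      (inj₁ refl)          (inj₁ eq)            = <⇒≢ (m≤n+m (suc a) 1) (sym eq)
  no-2-cycle (s≤s (s≤s ())) (inj₁ refl)          (inj₂ (refl , refl))
  no-2-cycle (s≤s (s≤s ())) (inj₂ (refl , refl)) (inj₁ refl)

  no-chord : ∀ {k a b c} → 4 ≤ k → Succ k a b → Succ k b c → ¬ Succ k a c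
  no-chord {b = b} _  (inj₁ refl)          (inj₁ refl)          (inj₁ eq)            = 1+n≢n (sym eq)
  no-chord _          (inj₁ refl)          (inj₁ refl)          (inj₂ (refl , ()))
  no-chord _          (inj₁ refl)          (inj₂ (refl , refl)) (inj₁ ())
  no-chord _          (inj₁ refl)          (inj₂ (refl , refl)) (inj₂ (eq , _))      = 1+n≢n (sym eq)
  no-chord (s≤s ())   (inj₂ (refl , refl)) (inj₁ refl)          (inj₁ refl)
  no-chord _          (inj₂ (refl , refl)) (inj₁ refl)          (inj₂ (_ , ()))
  no-chord _          (inj₂ (refl , refl)) (inj₂ (eq , refl))   (inj₁ ())
  no-chord (s≤s ())   (inj₂ (refl , refl)) (inj₂ (refl , refl)) (inj₂ _)

  no-3-cycle : ∀ {k a b c} → 4 ≤ k → Succ k a b → Succ k b c → ¬ Succ k c a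
  no-3-cycle {a = a} _            (inj₁ refl)          (inj₁ refl)          (inj₁ eq)            = <⇒≢ (m≤n+m (suc a) 2) (sym eq)
  no-3-cycle (s≤s (s≤s (s≤s ()))) (inj₁ refl)          (inj₁ refl)          (inj₂ (refl , refl))
  no-3-cycle (s≤s (s≤s (s≤s ()))) (inj₁ refl)          (inj₂ (refl , refl)) (inj₁ refl)
  no-3-cycle _                    (inj₁ refl)          (inj₂ (refl , refl)) (inj₂ (() , _))
  no-3-cycle (s≤s (s≤s (s≤s ()))) (inj₂ (refl , refl)) (inj₁ refl)          (inj₁ refl)

-- A tree decomposition in rooted form. By `climbs`, the nodes whose bags contain `v` are connected
-- through parents, with `top v` as the highest of them; decreasing depth makes every climb end.
module RootedDecomposition {n} {Node : Set} (Bag : Node → Fin n → Set)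
  (parent : Node → Node) (depth : Node → ℕ) (top : Fin n → Node)
  (climbs : ∀ v x → Bag x v → x ≡ top v ⊎ Bag (parent x) v × depth (parent x) < depth x)
  where

  depth-top-≤ : ∀ v x → Bag x v → depth (top v) ≤ depth x
  depth-top-≤ v x = go (suc (depth x)) x ≤-refl
    where
    go : ∀ b x → depth x < b → Bag x v → depth (top v) ≤ depth x
    go (suc b) x x<b x∋v with climbs v x x∋v
    ... | inj₁ refl       = ≤-refl
    ... | inj₂ (p∋v , p<x) =
      ≤-trans (go b (parent x) (<-≤-trans p<x (s≤s⁻¹ x<b)) p∋v) (<⇒≤ p<x)

  -- Climbing from `x` keeps both vertices until a top is met. If this were `top u` alone, the bag
  -- of the parent would still contain `v`, so `top v` would lie strictly above `top u`.
  shared-at-top : ∀ u v x → Bag x u → Bag x v → depth (top u) ≤ depth (top v) → Bag (top v) u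
  shared-at-top u v x = go (suc (depth x)) x ≤-refl
    where
    go : ∀ b x → depth x < b → Bag x u → Bag x v → depth (top u) ≤ depth (top v) → Bag (top v) u
    go (suc b) x x<b x∋u x∋v u≤v with climbs v x x∋v | climbs u x x∋u
    ... | inj₁ refl | _ = x∋u
    ... | inj₂ (p∋v , p<x) | inj₁ refl =
      contradiction (≤-trans u≤v (depth-top-≤ v _ p∋v)) (<⇒≱ p<x)
    ... | inj₂ (p∋v , p<x) | inj₂ (p∋u , _) =
      go b (parent x) (<-≤-trans p<x (s≤s⁻¹ x<b)) p∋u p∋v u≤v

  -- In an induced cycle, the two neighbours of a vertex with deepest top both
  -- lie in the bag at that top, so they are adjacent.
  chordal : (H : Graph n) → (∀ u v → Adj H u v ⇔ (u ≢ v × ∃[ x ] Bag x u × Bag x v)) → Chordal H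
  chordal H adj k@(suc _) 4≤k (c , c-injective , c-induced)
    with i , deepest ← argmax (depth ∘ top ∘ c)
    with h , hi ← cyclic-pred i | j , ij ← cyclic-succ i
    with h≢j , ¬hj , ¬jh ← cyclic-apart 4≤k h i j hi ij = ends (Equivalence.to (c-induced h j)
      (Equivalence.from (adj _ _) (h≢j ∘ c-injective , top (c i) ,
        at-top h (Equivalence.from (c-induced h i) (inj₁ hi)) ,
        at-top j (Equivalence.from (c-induced j i) (inj₂ ij)))))
    where
    at-top : ∀ l → Adj H (c l) (c i) → Bag (top (c i)) (c l)
    at-top l li with _ , x , x∋l , x∋i ← Equivalence.to (adj _ _) li =
      shared-at-top (c l) (c i) x x∋l x∋i (deepest l)
    ends : ¬ (CyclicSucc h j ⊎ CyclicSucc j h)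
    ends (inj₁ hj) = ¬hj hj
    ends (inj₂ jh) = ¬jh jh

-- Breadth-first trees in graphs given by darts.

record ShortestPathTree {n e} (org : Dart e → Fin n) (Usable : Fin e → Set) (root : Fin n) : Set where
  field
    dist      : Fin n → ℕ
    -- At the root this is an arbitrary dart leaving it, not a tree edge. In the dual tree it serves
    -- as the entry dart of the root face.
    up        : Fin n → Dart e
    org-up    : ∀ v → org (up v) ≡ v

  par : Fin n → Fin n
  par v = org (reverse (up v))

  field
    up-usable : ∀ {v} → v ≢ root → Usable (proj₁ (up v))
    dist-root : dist root ≡ 0
    dist-par  : ∀ {v} → v ≢ root → dist v ≡ suc (dist (par v))
    lipschitz : ∀ d → Usable (proj₁ d) → dist (org d) ≤ suc (dist (org (reverse d)))

  IsTreeEdge : Fin e → Set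
  IsTreeEdge i = ∃[ v ] v ≢ root × proj₁ (up v) ≡ i

  treeEdge? : Decidable IsTreeEdge
  treeEdge? i = Fin.any? λ v → ¬? (v Fin.≟ root) ×-dec proj₁ (up v) Fin.≟ i

  -- The default `a` stands in for the missing parent edge of the root. This gives an injection of
  -- the vertices into the edges and one extra element, as the count in `handles-bound` needs.
  parentEdge : ∀ {A : Set} → A → Fin n → Fin e ⊎ A
  parentEdge a v with v Fin.≟ root
  ... | yes _ = inj₂ a
  ... | no _  = inj₁ (proj₁ (up v))

  parentEdge-inj₁ : ∀ {A : Set} {a : A} {v i} → parentEdge a v ≡ inj₁ i → IsTreeEdge i
  parentEdge-inj₁ {v = v} eq with v Fin.≟ root | eq
  ... | yes _  | ()
  ... | no v≢r | refl = v , v≢r , refl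

  parentEdge-inj₂ : ∀ {A : Set} {a b : A} {v} → parentEdge a v ≡ inj₂ b → a ≡ b
  parentEdge-inj₂ {v = v} eq with v Fin.≟ root | eq
  ... | yes _ | refl = refl
  ... | no _  | ()

  up-edge-injective : ∀ {v w} → v ≢ root → w ≢ root → proj₁ (up v) ≡ proj₁ (up w) → v ≡ w
  up-edge-injective {v} {w} v≢r w≢r eq with same-edge (up v) (up w) eq
  ... | inj₁ same = trans (sym (org-up v)) (trans (cong org same) (org-up w))
  ... | inj₂ opp = contradiction (begin
    suc (suc (dist v))  ≡⟨ cong (λ x → suc (suc (dist x))) v≡ ⟩
    suc (suc (dist (par w))) ≡⟨ cong suc (dist-par w≢r) ⟨
    suc (dist w) ≡⟨ cong (λ x → suc (dist x)) w≡ ⟩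
    suc (dist (par v)) ≡⟨ dist-par v≢r ⟨
    dist v ∎) (<⇒≢ (m≤n+m (suc (dist v)) 1) ∘ sym)
    where
    open ≡-Reasoning
    v≡ : v ≡ par w
    v≡ = trans (sym (org-up v)) (cong org opp)
    w≡ : w ≡ par v
    w≡ = trans (sym (org-up w)) (cong org (trans (sym (reverse-involutive (up w))) (cong reverse (sym opp))))

  parentEdge-injective : ∀ {A : Set} (a : A) → Injective _≡_ _≡_ (parentEdge a)
  parentEdge-injective a {v} {w} eq with v Fin.≟ root | w Fin.≟ root | eq
  ... | yes v≡r | yes w≡r | _    = trans v≡r (sym w≡r)
  ... | no v≢r  | no w≢r  | same = up-edge-injective v≢r w≢r (inj₁-injective same)

module _ {n e} (org : Dart e → Fin n) {Usable : Fin e → Set} (usable? : Decidable Usable)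
         (root : Fin n) (org-onto : ∀ v → ∃[ d ] org d ≡ v)
         (reaches : ∀ v → Star (λ x y → ∃[ d ] Usable (proj₁ d) × org d ≡ x × org (reverse d) ≡ y) v root)
         where

  private
    Walk : ℕ → Fin n → Set
    Walk zero    v = v ≡ root
    Walk (suc k) v = ∃[ d ] Usable (proj₁ d) × org d ≡ v × Walk k (org (reverse d))

    walk? : ∀ v k → Dec (Walk k v)
    walk? v zero    = v Fin.≟ root
    walk? v (suc k) = anyDart? λ d → usable? (proj₁ d) ×-dec org d Fin.≟ v ×-dec walk? _ k

    walk : ∀ {v} → Star (λ x y → ∃[ d ] Usable (proj₁ d) × org d ≡ x × org (reverse d) ≡ y) v root →
           ∃[ k ] Walk k v
    walk ε = 0 , refl
    walk ((d , u , o , refl) ◅ s) with k , w ← walk s = suc k , d , u , o , w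

    nearest : ∀ v → ∃[ k ] Walk k v × (∀ j → Walk j v → k ≤ j)
    nearest v with k , w ← walk (reaches v) = least (walk? v) k w

    distance : Fin n → ℕ
    distance v = proj₁ (nearest v)

    distance-min : ∀ {v} k → Walk k v → distance v ≤ k
    distance-min {v} = proj₂ (proj₂ (nearest v))

    step : ∀ d → Usable (proj₁ d) → distance (org d) ≤ suc (distance (org (reverse d)))
    step d u = distance-min _ (d , u , refl , proj₁ (proj₂ (nearest (org (reverse d)))))

    FirstStep : Fin n → ℕ → Dart e → Set
    FirstStep v k d = org d ≡ v ×
      (v ≢ root → Usable (proj₁ d) × k ≡ suc (distance (org (reverse d))))

    first-step : ∀ v k → Walk k v → (∀ j → Walk j v → k ≤ j) → ∃ (FirstStep v k)
    first-step v zero    v≡r _ with d , o ← org-onto v = d , o , contradiction v≡r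
    first-step v (suc k) (d , u , refl , w) min = d , refl , λ _ → u , ≤-antisym
      (min _ (d , u , refl , proj₁ (proj₂ (nearest (org (reverse d))))))
      (s≤s (distance-min k w))

    toward : ∀ v → ∃ (FirstStep v (distance v))
    toward v = first-step v (distance v) (proj₁ (proj₂ (nearest v))) (proj₂ (proj₂ (nearest v)))

  abstract
    -- Applied with `origin` it gives a tree in the 1-skeleton, with `face` a tree in the dual
    -- graph, where only edges outside the first tree are usable.
    shortestPathTree : ShortestPathTree org Usable root
    shortestPathTree = record
      { dist      = distance
      ; up        = proj₁ ∘ toward
      ; org-up    = λ v → proj₁ (proj₂ (toward v))
      ; up-usable = λ v≢r → proj₁ (proj₂ (proj₂ (toward _)) v≢r)
      ; dist-root = n≤0⇒n≡0 (distance-min 0 refl)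
      ; dist-par  = λ v≢r → proj₂ (proj₂ (proj₂ (toward _)) v≢r)
      ; lipschitz = step
      }

-- Tree, cotree and handles of a cell decomposition.

infix 4 _≟ᵈ_
_≟ᵈ_ : ∀ {e} (d d′ : Dart e) → Dec (d ≡ d′)
_≟ᵈ_ = ≡-dec Fin._≟_ Bool._≟_

module TreeCotree {g} (M : CellDecomposition g) where
  open CellDecomposition M

  φ φ⁻¹ : Dart #E → Dart #E
  φ = rotate ∘ reverse
  φ⁻¹ = reverse ∘ Inverse.from rotation

  φ-φ⁻¹ : ∀ d → φ (φ⁻¹ d) ≡ d
  φ-φ⁻¹ d = trans (cong rotate (reverse-involutive _)) (Inverse.strictlyInverseˡ rotation d)

  φ⁻¹-φ : ∀ d → φ⁻¹ (φ d) ≡ d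
  φ⁻¹-φ d = trans (cong reverse (Inverse.strictlyInverseʳ rotation (reverse d))) (reverse-involutive d)

  φ-reverse : ∀ d → φ (reverse d) ≡ rotate d
  φ-reverse d = cong rotate (reverse-involutive d)

  origin-rotate : ∀ d → origin (rotate d) ≡ origin d
  origin-rotate d = sym (Equivalence.from (proj₂ origin-orbit d (rotate d)) (1 , refl))

  origin-φ : ∀ d → origin (φ d) ≡ origin (reverse d)
  origin-φ d = origin-rotate (reverse d)

  face-φ : ∀ d → face (φ d) ≡ face d
  face-φ d = sym (Equivalence.from (proj₂ face-orbit d (φ d)) (1 , refl))

  face-φ⁻¹ : ∀ d → face (φ⁻¹ d) ≡ face d
  face-φ⁻¹ d = trans (sym (face-φ (φ⁻¹ d))) (cong face (φ-φ⁻¹ d))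

  base : Dart #E
  base = fromℕ< nonempty , true

  abstract
    skeletonTree : ShortestPathTree origin (λ _ → ⊤) (origin base)
    skeletonTree = shortestPathTree origin (λ _ → yes tt) (origin base)
      (λ v → let d , o = proj₁ origin-orbit v in d , o refl)
      (λ v → Star.map (λ (d , j) → d , tt , j) (connected v (origin base)))

  module T = ShortestPathTree skeletonTree

  -- The ancestor of `w` on level `ℓ`. Truncated subtraction gives `w` itself if `ℓ` exceeds its
  -- level, and the iteration stops at the root at the latest, where `T.par` has no meaning.
  ancestor : ℕ → Fin #V → Fin #V
  ancestor ℓ w = iterate T.par w (T.dist w ∸ ℓ)

  infix 4 _≼_
  _≼_ : Rel (Fin #V) 0ℓ
  v ≼ w = ancestor (T.dist v) w ≡ v

  ≼-refl : ∀ v → v ≼ v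
  ≼-refl v rewrite n∸n≡0 (T.dist v) = refl

  ≼⇒dist≤ : ∀ {v w} → v ≼ w → T.dist v ≤ T.dist w
  ≼⇒dist≤ {v} {w} v≼w = ≮⇒≥ λ w<v → <⇒≢ w<v (cong T.dist
    (trans (cong (iterate T.par w) (sym (m≤n⇒m∸n≡0 (<⇒≤ w<v)))) v≼w))

  ≼-child : ∀ {v w} → w ≢ origin base → v ≼ T.par w → v ≼ w
  ≼-child {v} {w} w≢r v≼p = trans (cong (iterate T.par w)
    (trans (cong (_∸ T.dist v) (T.dist-par w≢r)) (+-∸-assoc 1 (≼⇒dist≤ {v} {T.par w} v≼p)))) v≼p

  ≼-parent : ∀ {v w} → v ≼ w → w ≢ v → w ≢ origin base × v ≼ T.par w
  ≼-parent {v} {w} v≼w w≢v = w≢r , v≼p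
    where
    v<w : T.dist v < T.dist w
    v<w = ≤∧≢⇒< (≼⇒dist≤ v≼w) λ v≡w →
      w≢v (trans (cong (iterate T.par w) (sym (m≤n⇒m∸n≡0 (≤-reflexive (sym v≡w))))) v≼w)
    w≢r : w ≢ origin base
    w≢r refl = contradiction (subst (T.dist v <_) T.dist-root v<w) λ ()
    v≼p : v ≼ T.par w
    v≼p = trans (cong (iterate T.par w) (begin
      suc (T.dist (T.par w) ∸ T.dist v) ≡⟨ +-∸-assoc 1 (s≤s⁻¹ (subst (T.dist v <_) (T.dist-par w≢r) v<w)) ⟨
      suc (T.dist (T.par w)) ∸ T.dist v ≡⟨ cong (_∸ T.dist v) (T.dist-par w≢r) ⟨
      T.dist w ∸ T.dist v ∎)) v≼w
      where open ≡-Reasoning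

  ≼-induction : ∀ v (P : Fin #V → Set) → P v → (∀ w → w ≢ origin base → v ≼ T.par w → P (T.par w) → P w) →
                ∀ w → v ≼ w → P w
  ≼-induction v P here there w = go (suc (T.dist w)) w ≤-refl
    where
    go : ∀ b w → T.dist w < b → v ≼ w → P w
    go (suc b) w w<b v≼w with w Fin.≟ v
    ... | yes refl = here
    ... | no w≢v with w≢r , v≼p ← ≼-parent v≼w w≢v =
      there w w≢r v≼p (go b (T.par w) (s≤s⁻¹ (subst (_< suc b) (T.dist-par w≢r) w<b)) v≼p)

  root-≼ : ∀ w → origin base ≼ w
  root-≼ w = go (suc (T.dist w)) w ≤-refl
    where
    go : ∀ b w → T.dist w < b → origin base ≼ w
    go (suc b) w w<b with w Fin.≟ origin base
    ... | yes refl = ≼-refl w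
    ... | no w≢r = ≼-child w≢r (go b (T.par w) (s≤s⁻¹ (subst (_< suc b) (T.dist-par w≢r) w<b)))

  -- A walk around the subtree of T hanging from v visits all its corners; it
  -- passes from a corner to the next across a non-tree edge or along a tree edge.
  module _ {_~_ : Rel (Dart #E) 0ℓ} (~-isEquivalence : IsEquivalence _~_) (v : Fin #V)
    (cross : ∀ x → v ≼ origin x → ¬ T.IsTreeEdge (proj₁ x) → x ~ reverse x)
    (turn  : ∀ x → v ≼ origin (φ x) → x ~ φ x) where

    open IsEquivalence ~-isEquivalence renaming (refl to ~-refl; sym to ~-sym; trans to ~-trans)

    private
      turn-reverse : ∀ x → v ≼ origin x → reverse x ~ rotate x
      turn-reverse x v≼x = subst (reverse x ~_) (φ-reverse x)
        (turn (reverse x) (subst (v ≼_) (sym (trans (cong origin (φ-reverse x)) (origin-rotate x))) v≼x))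

      height : ∃[ H ] ∀ w → T.dist w ≤ H
      height = bounded T.dist

      -- Induction from the deepest level upwards, with `b` as fuel. Rotating once around `w`,
      -- starting just after `T.up w`, each step crosses a non-tree edge or goes around the subtree
      -- of a child; `T.up w` itself, which may leave the subtree of `v`, is never crossed.
      around-vertex : ∀ b w → proj₁ height < b + T.dist w → v ≼ w →
                      ∀ x → origin x ≡ w → x ~ rotate (T.up w)
      around-vertex zero    w H<w = contradiction (proj₂ height w) (<⇒≱ H<w)
      around-vertex (suc b) w H<w v≼w x x-at-w = conclude
        (Equivalence.to (proj₂ origin-orbit (rotate (T.up w)) x)
          (trans (origin-rotate (T.up w)) (trans (T.org-up w) (sym x-at-w))))
        where
        step : ∀ y → origin y ≡ w → y ≢ T.up w → y ~ rotate y
        step y refl y≢up with T.treeEdge? (proj₁ y)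
        ... | no ¬tree = ~-trans (cross y v≼w ¬tree) (turn-reverse y v≼w)
        ... | yes (c , c≢r , same) with same-edge (T.up c) y same
        ...   | inj₁ up≡y = contradiction
                  (trans (sym up≡y) (cong T.up (trans (sym (T.org-up c)) (cong origin up≡y)))) y≢up
        -- `y` leads down to the child `c`: turn to `φ y` at `c`, get back to `T.up c` by the
        -- recursive call at `c`, then turn to `rotate y` at `w`.
        ...   | inj₂ up≡ = ~-trans (turn y v≼φy)
                  (~-trans (~-sym (subst (_~ φ y) up≡ up~)) (turn-reverse y v≼w))
          where
          par≡ : T.par c ≡ w
          par≡ = cong origin (trans (cong reverse up≡) (reverse-involutive y))
          v≼c : v ≼ c
          v≼c = ≼-child c≢r (subst (v ≼_) (sym par≡) v≼w)
          v≼φy : v ≼ origin (φ y)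
          v≼φy = subst (v ≼_) (trans (sym (T.org-up c)) (trans (cong origin up≡) (sym (origin-φ y)))) v≼c
          H<c : proj₁ height < b + T.dist c
          H<c rewrite T.dist-par c≢r | par≡ | +-suc b (T.dist w) = H<w
          up~ : T.up c ~ φ y
          up~ = subst (λ z → T.up c ~ rotate z) up≡ (around-vertex b c H<c v≼c (T.up c) (T.org-up c))

        from-up : ∀ k → let y = fold (rotate (T.up w)) rotate k in origin y ≡ w × y ~ rotate (T.up w)
        from-up zero = trans (origin-rotate (T.up w)) (T.org-up w) , ~-refl
        from-up (suc k) with y-at-w , y~ ← from-up k = trans (origin-rotate _) y-at-w , extend
          where
          extend : rotate (fold (rotate (T.up w)) rotate k) ~ rotate (T.up w)
          extend with fold (rotate (T.up w)) rotate k ≟ᵈ T.up w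
          ... | yes y≡up = subst (λ y → rotate y ~ rotate (T.up w)) (sym y≡up) ~-refl
          ... | no y≢up  = ~-trans (~-sym (step _ y-at-w y≢up)) y~

        conclude : SameOrbit rotate (rotate (T.up w)) x → x ~ rotate (T.up w)
        conclude (k , refl) = proj₂ (from-up k)

      at-vertex : ∀ w → v ≼ w → ∀ x → origin x ≡ w → x ~ rotate (T.up w)
      at-vertex w = around-vertex (suc (proj₁ height)) w (s≤s (m≤m+n _ _))

    around-subtree : ∀ x → v ≼ origin x → x ~ rotate (T.up v)
    around-subtree x v≼x = ~-trans (at-vertex (origin x) v≼x x refl)
      (≼-induction v (λ w → rotate (T.up w) ~ rotate (T.up v)) ~-refl descend (origin x) v≼x)
      where
      descend : ∀ w → w ≢ origin base → v ≼ T.par w →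
                rotate (T.up (T.par w)) ~ rotate (T.up v) → rotate (T.up w) ~ rotate (T.up v)
      descend w w≢r v≼p ih = ~-trans (~-sym (turn-reverse (T.up w) v≼up))
        (~-trans (at-vertex (T.par w) v≼p (reverse (T.up w)) refl) ih)
        where
        v≼up : v ≼ origin (T.up w)
        v≼up = subst (v ≼_) (sym (T.org-up w)) (≼-child w≢r v≼p)

  private
    CrossesTo : Rel (Fin #F) 0ℓ
    CrossesTo a b = ∃[ d ] ¬ T.IsTreeEdge (proj₁ d) × face d ≡ a × face (reverse d) ≡ b

    crosses-sym : Symmetric CrossesTo
    crosses-sym (d , ¬tree , refl , refl) = reverse d , ¬tree , refl , cong face (reverse-involutive d)

    -- The dual graph stays connected without the edges of the tree: in the walk around the whole
    -- tree, a turn keeps the face and a crossing passes through a non-tree edge.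
    faces-joined : ∀ d d′ → Star CrossesTo (face d) (face d′)
    faces-joined d d′ = to-root d ◅◅ Star.reverse crosses-sym (to-root d′)
      where
      to-root : ∀ d → Star CrossesTo (face d) (face (rotate (T.up (origin base))))
      to-root d = around-subtree {_~_ = λ x y → Star CrossesTo (face x) (face y)}
        (record { refl = ε ; sym = Star.reverse crosses-sym ; trans = _◅◅_ })
        (origin base)
        (λ x _ ¬tree → (x , ¬tree , refl , refl) ◅ ε)
        (λ x _ → subst (Star CrossesTo (face x)) (sym (face-φ x)) ε)
        d (root-≼ (origin d))

  abstract
    dualTree : ShortestPathTree face (λ i → ¬ T.IsTreeEdge i) (face base)
    dualTree = shortestPathTree face (λ i → ¬? (T.treeEdge? i)) (face base) onto
      (λ f → let d , d-in-f = onto f in subst (λ f → Star CrossesTo f (face base)) d-in-f (faces-joined d base))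
      where
      onto : ∀ f → ∃[ d ] face d ≡ f
      onto f = let d , o = proj₁ face-orbit f in d , o refl

  module D = ShortestPathTree dualTree

  IsHandle : Fin #E → Set
  IsHandle i = ¬ T.IsTreeEdge i × ¬ D.IsTreeEdge i

  handle? : Decidable IsHandle
  handle? i = ¬? (T.treeEdge? i) ×-dec ¬? (D.treeEdge? i)

  handles : List (Fin #E)
  handles = filter handle? (allFin #E)

  lookup-handle : ∀ i → IsHandle (lookup handles i)
  lookup-handle i = proj₂ (∈-filter⁻ handle? {xs = allFin #E} (∈-lookup {xs = handles} i))

  handle-index : ∀ {i} → IsHandle i → ∃[ j ] lookup handles j ≡ i
  handle-index h = index i∈ , sym (lookup-index i∈)
    where i∈ = ∈-filter⁺ handle? (∈-allFin _) h

  -- The edges of T, the edges of D and the handles are disjoint; the two roots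
  -- account for the 2 in Euler's formula.
  handles-bound : length handles ≤ 2 * g
  handles-bound = +-cancelˡ-≤ (#V + #F) (length handles) (2 * g) (begin
    #V + #F + length handles   ≡⟨ +-assoc #V #F _ ⟩
    #V + (#F + length handles) ≤⟨ Fin.injective⇒≤ number-injective ⟩
    #E + 2                     ≡⟨ euler ⟨
    #V + #F + 2 * g            ∎)
    where
    open ≤-Reasoning
    cell : Fin #V ⊎ Fin #F ⊎ Fin (length handles) → Fin #E ⊎ Fin 2
    cell (inj₁ v)        = T.parentEdge zero v
    cell (inj₂ (inj₁ f)) = D.parentEdge (suc zero) f
    cell (inj₂ (inj₂ i)) = inj₁ (lookup handles i)

    T≢D : ∀ v f → T.parentEdge {Fin 2} zero v ≢ D.parentEdge (suc zero) f
    T≢D v f eq with T.parentEdge {Fin 2} zero v in v-edge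
    ... | inj₁ i with c , c≢r , refl ← D.parentEdge-inj₁ {v = f} (sym eq) =
      D.up-usable c≢r (T.parentEdge-inj₁ {v = v} v-edge)
    ... | inj₂ b with () ← trans (T.parentEdge-inj₂ {v = v} v-edge) (sym (D.parentEdge-inj₂ {v = f} (sym eq)))

    T≢handle : ∀ v i → T.parentEdge {Fin 2} zero v ≢ inj₁ (lookup handles i)
    T≢handle v i eq = proj₁ (lookup-handle i) (T.parentEdge-inj₁ {v = v} eq)

    D≢handle : ∀ f i → D.parentEdge {Fin 2} (suc zero) f ≢ inj₁ (lookup handles i)
    D≢handle f i eq = proj₂ (lookup-handle i) (D.parentEdge-inj₁ {v = f} eq)

    cell-injective : ∀ x y → cell x ≡ cell y → x ≡ y
    cell-injective (inj₁ v) (inj₁ w) eq = cong inj₁ (T.parentEdge-injective zero eq)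
    cell-injective (inj₁ v) (inj₂ (inj₁ f)) eq = contradiction eq (T≢D v f)
    cell-injective (inj₁ v) (inj₂ (inj₂ i)) eq = contradiction eq (T≢handle v i)
    cell-injective (inj₂ (inj₁ f)) (inj₁ v) eq = contradiction (sym eq) (T≢D v f)
    cell-injective (inj₂ (inj₁ f)) (inj₂ (inj₁ f′)) eq =
      cong (inj₂ ∘ inj₁) (D.parentEdge-injective (suc zero) eq)
    cell-injective (inj₂ (inj₁ f)) (inj₂ (inj₂ i)) eq = contradiction eq (D≢handle f i)
    cell-injective (inj₂ (inj₂ i)) (inj₁ v) eq = contradiction (sym eq) (T≢handle v i)
    cell-injective (inj₂ (inj₂ i)) (inj₂ (inj₁ f)) eq = contradiction (sym eq) (D≢handle f i)
    cell-injective (inj₂ (inj₂ i)) (inj₂ (inj₂ j)) eq = cong (inj₂ ∘ inj₂)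
      (lookup-injective (filter⁺ handle? (allFin⁺ #E)) (inj₁-injective eq))

    split : Fin (#V + (#F + length handles)) → Fin #V ⊎ Fin #F ⊎ Fin (length handles)
    split x = [ inj₁ , inj₂ ∘ splitAt #F ]′ (splitAt #V x)

    unsplit : Fin #V ⊎ Fin #F ⊎ Fin (length handles) → Fin (#V + (#F + length handles))
    unsplit (inj₁ v) = join #V _ (inj₁ v)
    unsplit (inj₂ y) = join #V _ (inj₂ (join #F _ y))

    unsplit-split : ∀ x → unsplit (split x) ≡ x
    unsplit-split x with splitAt #V x in eq
    ... | inj₁ v = trans (cong (join #V _) (sym eq)) (Fin.join-splitAt #V _ x)
    ... | inj₂ y = trans (cong (join #V _ ∘ inj₂) (Fin.join-splitAt #F _ y))
                     (trans (cong (join #V _) (sym eq)) (Fin.join-splitAt #V _ x))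

    number : Fin (#V + (#F + length handles)) → Fin (#E + 2)
    number = join #E 2 ∘ cell ∘ split

    number-injective : Injective _≡_ _≡_ number
    number-injective {x} {y} eq = trans (sym (unsplit-split x)) (trans
      (cong unsplit (cell-injective (split x) (split y)
        (trans (sym (Fin.splitAt-join #E 2 _)) (trans (cong (splitAt #E) eq) (Fin.splitAt-join #E 2 _)))))
      (unsplit-split y))

-- The tree of triangles and its bags.

module BagsOfDarts {g} (M : CellDecomposition g) where
  open CellDecomposition M
  open TreeCotree M

  -- A dart stands for the triangle on its side of its edge. Within a face the fan is followed back
  -- to the entry dart, which is then crossed into the parent face in the dual tree. At the root
  -- node the value has no meaning.
  parent : Dart #E → Dart #E
  parent d with d ≟ᵈ D.up (face d)
  ... | yes _ = reverse d
  ... | no _  = φ⁻¹ d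

  parent-entry : ∀ {d} → d ≡ D.up (face d) → parent d ≡ reverse d
  parent-entry {d} entry with d ≟ᵈ D.up (face d)
  ... | yes _     = refl
  ... | no ¬entry = contradiction entry ¬entry

  parent-inside : ∀ {d} → d ≢ D.up (face d) → parent d ≡ φ⁻¹ d
  parent-inside {d} ¬entry with d ≟ᵈ D.up (face d)
  ... | yes entry = contradiction entry ¬entry
  ... | no _      = refl

  rootNode : Dart #E
  rootNode = D.up (face base)

  face-rootNode : face rootNode ≡ face base
  face-rootNode = D.org-up (face base)

  private
    abstract
      position : ∀ d → ∃[ k ] fold (D.up (face d)) φ k ≡ d × (∀ j → fold (D.up (face d)) φ j ≡ d → k ≤ j)
      position d with k , eq ← Equivalence.to (proj₂ face-orbit (D.up (face d)) d) (D.org-up (face d)) =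
        least (λ j → fold (D.up (face d)) φ j ≟ᵈ d) k eq

    index-in-face : Dart #E → ℕ
    index-in-face d = proj₁ (position d)

    index-φ⁻¹ : ∀ {d} → d ≢ D.up (face d) → index-in-face (φ⁻¹ d) < index-in-face d
    index-φ⁻¹ {d} ¬entry with position d
    ... | zero  , eq , _ = contradiction (sym eq) ¬entry
    ... | suc k , eq , _ = s≤s (proj₂ (proj₂ (position (φ⁻¹ d))) k
      (trans (cong (λ f → fold (D.up f) φ k) (face-φ⁻¹ d)) (trans (sym (φ⁻¹-φ _)) (cong φ⁻¹ eq))))

    max-index : ∃[ m ] ∀ d → index-in-face d ≤ m
    max-index = boundedᵈ index-in-face

  -- Lexicographic: the dual distance of the face first, then the number of steps from its entry
  -- dart. Crossing an entry dart lowers the first, stepping back within a face the second.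
  depth : Dart #E → ℕ
  depth d = D.dist (face d) * suc (proj₁ max-index) + index-in-face d

  depth-parent : ∀ {d} → d ≢ rootNode → depth (parent d) < depth d
  depth-parent {d} ¬root with d ≟ᵈ D.up (face d)
  ... | no ¬entry rewrite face-φ⁻¹ d = +-monoʳ-< (D.dist (face d) * suc (proj₁ max-index)) (index-φ⁻¹ ¬entry)
  ... | yes entry = begin-strict
    a * suc m + index-in-face (reverse d) ≤⟨ +-monoʳ-≤ (a * suc m) (proj₂ max-index (reverse d)) ⟩
    a * suc m + m                         <⟨ +-monoʳ-< (a * suc m) (n<1+n m) ⟩
    a * suc m + suc m                     ≡⟨ +-comm (a * suc m) (suc m) ⟩
    suc a * suc m                         ≡⟨ cong (_* suc m) closer ⟨
    D.dist (face d) * suc m               ≤⟨ m≤m+n _ _ ⟩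
    depth d                               ∎
    where
    open ≤-Reasoning
    m = proj₁ max-index
    a = D.dist (face (reverse d))
    closer : D.dist (face d) ≡ suc a
    closer = trans (D.dist-par (λ f≡ → ¬root (trans entry (cong D.up f≡))))
                   (cong (λ x → suc (D.dist (face (reverse x)))) (sym entry))

  -- The corners of the triangle cut off at d when the face is triangulated from
  -- the origin of its entry dart.
  corner : Dart #E → Fin 3 → Dart #E
  corner d zero             = d
  corner d (suc zero)       = φ d
  corner d (suc (suc zero)) = D.up (face d)

  Near : Dart #E → Fin #V → Set
  Near d v = ∃[ i ] v ≼ origin (corner d i)

  near? : ∀ d v → Dec (Near d v)
  near? d v = Fin.any? λ i → _ Fin.≟ v

  -- The walk around the subtree of such a vertex can be blocked at a handle, so the vertex is put
  -- into every bag instead.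
  Spread : Fin #V → Set
  Spread v = ∃[ x ] IsHandle (proj₁ x) × v ≼ origin x

  spread? : Decidable Spread
  spread? v = anyDart? λ x → handle? (proj₁ x) ×-dec (_ Fin.≟ v)

  Bag : Dart #E → Fin #V → Set
  Bag d v = Spread v ⊎ Near d v

  bag? : ∀ d v → Dec (Bag d v)
  bag? d v = spread? v ⊎-dec near? d v

  data ClimbsTo (v : Fin #V) : Dart #E → Dart #E → Set where
    stop  : ∀ {d} → d ≡ rootNode ⊎ ¬ Near (parent d) v → ClimbsTo v d d
    climb : ∀ {d t} → d ≢ rootNode → Near (parent d) v → ClimbsTo v (parent d) t → ClimbsTo v d t

  climbs-to-some : ∀ v d → ∃ (ClimbsTo v d)
  climbs-to-some v d = go (suc (depth d)) d ≤-refl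
    where
    go : ∀ b d → depth d < b → ∃ (ClimbsTo v d)
    go (suc b) d d<b with d ≟ᵈ rootNode | near? (parent d) v
    ... | yes root | _         = d , stop (inj₁ root)
    ... | no _     | no ¬near  = d , stop (inj₂ ¬near)
    ... | no ¬root | yes near
      with t , c ← go b (parent d) (<-≤-trans (depth-parent ¬root) (s≤s⁻¹ d<b)) =
      t , climb ¬root near c

  -- The equivalence to which `around-subtree` is applied. Comparing all possible ends of climbs
  -- expresses connectedness of the bags near `v` without any paths between them.
  SameTop : Fin #V → Rel (Dart #E) 0ℓ
  SameTop v d d′ = ∀ t → ClimbsTo v d t ⇔ ClimbsTo v d′ t

  sameTop-isEquivalence : ∀ v → IsEquivalence (SameTop v)
  sameTop-isEquivalence v = record
    { refl  = λ t → mk⇔ id id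
    ; sym   = λ p t → mk⇔ (Equivalence.from (p t)) (Equivalence.to (p t))
    ; trans = λ p q t → mk⇔ (Equivalence.to (q t) ∘ Equivalence.to (p t))
                            (Equivalence.from (p t) ∘ Equivalence.from (q t))
    }

  sameTop-parent : ∀ {v d p} → d ≢ rootNode → parent d ≡ p → Near p v → SameTop v d p
  sameTop-parent ¬root refl near t = mk⇔
    (λ { (stop (inj₁ root))  → contradiction root ¬root
       ; (stop (inj₂ ¬near)) → contradiction near ¬near
       ; (climb _ _ c)       → c })
    (climb ¬root near)

  module _ {v : Fin #V} where
    open IsEquivalence (sameTop-isEquivalence v)
      renaming (refl to ~-refl; sym to ~-sym; trans to ~-trans) using ()

    -- All triangles of the face share the origin of the entry dart as apex, so the whole climb to
    -- the entry stays near `v`.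
    sameTop-entry : ∀ d → v ≼ origin (D.up (face d)) → SameTop v d (D.up (face d))
    sameTop-entry d = go (suc (index-in-face d)) d ≤-refl
      where
      go : ∀ b d → index-in-face d < b → v ≼ origin (D.up (face d)) → SameTop v d (D.up (face d))
      go (suc b) d d<b v≼entry with d ≟ᵈ D.up (face d)
      ... | yes entry = subst (SameTop v d) entry ~-refl
      ... | no ¬entry = ~-trans
        (sameTop-parent (λ { refl → ¬entry (cong D.up (sym face-rootNode)) })
          (parent-inside ¬entry) (suc (suc zero) , v≼entry′))
        (subst (λ f → SameTop v (φ⁻¹ d) (D.up f)) (face-φ⁻¹ d)
          (go b (φ⁻¹ d) (<-≤-trans (index-φ⁻¹ ¬entry) (s≤s⁻¹ d<b)) v≼entry′))
        where
        v≼entry′ : v ≼ origin (D.up (face (φ⁻¹ d)))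
        v≼entry′ = subst (λ f → v ≼ origin (D.up f)) (sym (face-φ⁻¹ d)) v≼entry

    -- Either `φ x` is the entry dart and its origin is the apex of the face, or `x` is the parent
    -- of `φ x` and has the origin of `φ x` as a corner.
    sameTop-φ : ∀ x → v ≼ origin (φ x) → SameTop v x (φ x)
    sameTop-φ x v≼φx with φ x ≟ᵈ D.up (face (φ x))
    ... | yes entry = subst (SameTop v x) x-entry
      (sameTop-entry x (subst (λ y → v ≼ origin y) (sym x-entry) v≼φx))
      where
      x-entry : D.up (face x) ≡ φ x
      x-entry = trans (cong D.up (sym (face-φ x))) (sym entry)
    ... | no ¬entry = ~-sym (sameTop-parent
      (λ root → ¬entry (trans root (cong D.up (trans (sym face-rootNode) (cong face (sym root))))))
      (trans (parent-inside ¬entry) (φ⁻¹-φ x)) (suc zero , v≼φx))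

    sameTop-up : ∀ {f} → f ≢ face base → Near (reverse (D.up f)) v → SameTop v (D.up f) (reverse (D.up f))
    sameTop-up {f} f≢r = sameTop-parent
      (λ root → f≢r (trans (sym (D.org-up f)) (trans (cong face root) face-rootNode)))
      (parent-entry (cong D.up (sym (D.org-up f))))

    -- A non-tree edge with an end below `v` is not a handle, so it belongs to the dual tree. Then
    -- one of its darts is the parent of the other, and the parent triangle has both ends of the
    -- edge as corners.
    sameTop-reverse : ¬ Spread v → ∀ x → v ≼ origin x → ¬ T.IsTreeEdge (proj₁ x) →
                      SameTop v x (reverse x)
    sameTop-reverse ¬spread x v≼x ¬tree with D.treeEdge? (proj₁ x)
    ... | no ¬dual = contradiction (x , (¬tree , ¬dual) , v≼x) ¬spread
    ... | yes (f , f≢r , same) with same-edge (D.up f) x same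
    ...   | inj₁ refl = sameTop-up f≢r (suc zero , subst (v ≼_) (sym φ-reverse-origin) v≼x)
      where
      φ-reverse-origin : origin (φ (reverse x)) ≡ origin x
      φ-reverse-origin = trans (cong origin (φ-reverse x)) (origin-rotate x)
    ...   | inj₂ up≡ = ~-sym (subst (λ y → SameTop v y x) up≡
      (subst (SameTop v (D.up f)) reverse-up≡ (sameTop-up f≢r (zero , subst (λ y → v ≼ origin y) (sym reverse-up≡) v≼x))))
      where
      reverse-up≡ : reverse (D.up f) ≡ x
      reverse-up≡ = trans (cong reverse up≡) (reverse-involutive x)

    sameTop-near : ¬ Spread v → ∀ d → Near d v → SameTop v d (rotate (T.up v))
    sameTop-near ¬spread d near = from-corner near
      where
      around : ∀ x → v ≼ origin x → SameTop v x (rotate (T.up v))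
      around = around-subtree (sameTop-isEquivalence v) v (sameTop-reverse ¬spread) sameTop-φ
      from-corner : Near d v → SameTop v d (rotate (T.up v))
      from-corner (zero , v≼) = around d v≼
      from-corner (suc zero , v≼) = ~-trans (sameTop-φ d v≼) (around (φ d) v≼)
      from-corner (suc (suc zero) , v≼) = ~-trans (sameTop-entry d v≼) (around (D.up (face d)) v≼)

  abstract
    top : Fin #V → Dart #E
    top v with spread? v
    ... | yes _ = rootNode
    -- The climb starts from the reference dart at which `around-subtree` ends.
    ... | no _  = proj₁ (climbs-to-some v (rotate (T.up v)))

    bag-climbs : ∀ v d → Bag d v → d ≡ top v ⊎ Bag (parent d) v × depth (parent d) < depth d
    bag-climbs v d bag with spread? v
    bag-climbs v d bag | yes spread with d ≟ᵈ rootNode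
    ... | yes root = inj₁ root
    ... | no ¬root = inj₂ (inj₁ spread , depth-parent ¬root)
    bag-climbs v d (inj₁ spread) | no ¬spread = contradiction spread ¬spread
    bag-climbs v d (inj₂ near)   | no ¬spread
      with t , c ← climbs-to-some v (rotate (T.up v))
      -- The climb from the reference dart becomes one from `d` to the same end; its first
      -- constructor tells whether `d` is that end or its parent is near `v`.
      with Equivalence.from (sameTop-near ¬spread d near t) c
    ... | stop _           = inj₁ refl
    ... | climb ¬root near _ = inj₂ (inj₂ near , depth-parent ¬root)

  joined-share-bag : ∀ {d u v} → Joins d u v → Bag d u × Bag d v
  joined-share-bag {d} (refl , refl) =
    inj₂ (zero , ≼-refl _) ,
    inj₂ (suc zero , subst (_≼ origin (φ d)) (origin-φ d) (≼-refl _))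

  Mark : Set
  Mark = Dart (length handles) ⊎ Fin 4

  SharesBag : Rel (Fin #V) 0ℓ
  SharesBag u v = ∃[ d ] Bag d u × Bag d v

  private
    Conflict : Rel (Fin #V) 0ℓ
    Conflict u v = T.dist u ≡ T.dist v × ¬ Spread u × ¬ Spread v × SharesBag u v

    -- The bag at `top v` contains `u`, which is not spread and so is an ancestor of one of the
    -- three corners. Each corner has one ancestor on the common level, hence three candidates and
    -- four colours.
    conflict-covered : ∀ u v → Conflict u v → depth (top u) ≤ depth (top v) →
                       ∃[ i ] ancestor (T.dist v) (origin (corner (top v) i)) ≡ u
    conflict-covered u v (level , ¬su , _ , d , d∋u , d∋v) u≤v
      with RootedDecomposition.shared-at-top Bag parent depth top bag-climbs u v d d∋u d∋v u≤v
    ... | inj₁ su       = contradiction su ¬su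
    ... | inj₂ (i , u≼) = i , trans (cong (λ ℓ → ancestor ℓ (origin (corner (top v) i))) (sym level)) u≼

    abstract
      greedy : Σ[ col ∈ (Fin #V → Fin 4) ] (∀ u v → u ≢ v → Conflict u v → col u ≢ col v)
      greedy = greedy-colouring Conflict
        (λ (level , ¬su , ¬sv , d , d∋u , d∋v) → sym level , ¬sv , ¬su , d , d∋v , d∋u)
        (depth ∘ top) (λ v i → ancestor (T.dist v) (origin (corner (top v) i))) conflict-covered

    -- A spread vertex is determined by its level and any handle end below it.
    markOf : ∀ {v} → Dec (Spread v) → Mark
    markOf     (yes ((_ , b) , handle , _)) = inj₁ (proj₁ (handle-index handle) , b)
    markOf {v} (no _)                       = inj₂ (proj₁ greedy v)

  mark : Fin #V → Mark
  mark v = markOf (spread? v)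

  mark-proper : ∀ {u v} → u ≢ v → T.dist u ≡ T.dist v → SharesBag u v → mark u ≢ mark v
  mark-proper {u} {v} u≢v level share = proper (spread? u) (spread? v)
    where
    proper : (p : Dec (Spread u)) (q : Dec (Spread v)) → markOf p ≢ markOf q
    proper (no ¬su) (no ¬sv) eq = proj₂ greedy u v u≢v (level , ¬su , ¬sv , share) (inj₂-injective eq)
    proper (yes ((i , b) , hᵢ , u≼)) (yes ((j , c) , hⱼ , v≼)) eq = u≢v (begin
      u                                    ≡⟨ u≼ ⟨
      ancestor (T.dist u) (origin (i , b)) ≡⟨ cong₂ (λ ℓ x → ancestor ℓ (origin x)) level ib≡jc ⟩
      ancestor (T.dist v) (origin (j , c)) ≡⟨ v≼ ⟩
      v                                    ∎)
      where
      open ≡-Reasoning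
      ib≡jc : (i , b) ≡ (j , c)
      ib≡jc = cong₂ _,_
        (trans (sym (proj₂ (handle-index hᵢ)))
          (trans (cong (lookup handles ∘ proj₁) (inj₁-injective eq)) (proj₂ (handle-index hⱼ))))
        (cong proj₂ (inj₁-injective eq))

-- Levels: unit intervals and parity.

levelGraph : ∀ {n} → (Fin n → ℕ) → Graph n
levelGraph level = record
  { Adj         = λ u v → u ≢ v × level u ≤ suc (level v) × level v ≤ suc (level u)
  ; symmetric   = λ (u≢v , a , b) → u≢v ∘ sym , b , a
  ; irreflexive = λ u≡v (u≢v , _) → u≢v u≡v
  ; decidable   = λ u v → ¬? (u Fin.≟ v) ×-dec level u ≤? suc (level v) ×-dec level v ≤? suc (level u)
  }

fromℕ : ℕ → ℚ
fromℕ zero    = 0ℚ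
fromℕ (suc n) = fromℕ n ℚ.+ 1ℚ

fromℕ-< : ∀ n → fromℕ n ℚ.< fromℕ (suc n)
fromℕ-< n = subst (ℚ._< fromℕ (suc n)) (ℚ.+-identityʳ (fromℕ n))
  (ℚ.+-monoʳ-< (fromℕ n) (ℚ.positive⁻¹ 1ℚ))

fromℕ-mono-≤ : ∀ {m n} → m ≤ n → fromℕ m ℚ.≤ fromℕ n
fromℕ-mono-≤ m≤n = go (≤⇒≤′ m≤n)
  where
  go : ∀ {m n} → m ≤′ n → fromℕ m ℚ.≤ fromℕ n
  go ≤′-refl       = ℚ.≤-refl
  go {n = suc n} (≤′-step m≤n) = ℚ.≤-trans (go m≤n) (ℚ.<⇒≤ (fromℕ-< n))

fromℕ-cancel-≤ : ∀ {m n} → fromℕ m ℚ.≤ fromℕ n → m ≤ n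
fromℕ-cancel-≤ {m} {n} m≤n = ≮⇒≥ λ n<m →
  ℚ.<-irrefl refl (ℚ.<-≤-trans (fromℕ-< n) (ℚ.≤-trans (fromℕ-mono-≤ n<m) m≤n))

levelGraph-unitInterval : ∀ {n} (level : Fin n → ℕ) → UnitInterval (levelGraph level)
levelGraph-unitInterval level = fromℕ ∘ level , λ u v → mk⇔
  -- The later of the two starting points lies in both intervals.
  (λ (u≢v , u≤ , v≤) → u≢v , fromℕ (level u ⊔ level v) ,
    (fromℕ-mono-≤ (m≤m⊔n (level u) (level v)) , fromℕ-mono-≤ (⊔-lub (n≤1+n _) v≤)) ,
    (fromℕ-mono-≤ (m≤n⊔m (level u) (level v)) , fromℕ-mono-≤ (⊔-lub u≤ (n≤1+n _))))
  (λ (u≢v , t , (u≤t , t≤u) , (v≤t , t≤v)) →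
    u≢v , fromℕ-cancel-≤ (ℚ.≤-trans u≤t t≤v) , fromℕ-cancel-≤ (ℚ.≤-trans v≤t t≤u))

isOdd : ℕ → Bool
isOdd zero    = false
isOdd (suc n) = not (isOdd n)

close-same-parity⇒≡ : ∀ {m n} → m ≤ suc n → n ≤ suc m → isOdd m ≡ isOdd n → m ≡ n
close-same-parity⇒≡ {zero}        {zero}        _ _ _  = refl
close-same-parity⇒≡ {zero}        {suc zero}    _ _ ()
close-same-parity⇒≡ {zero}        {suc (suc _)} _ (s≤s ())
close-same-parity⇒≡ {suc zero}    {zero}        _ _ ()
close-same-parity⇒≡ {suc (suc _)} {zero}        (s≤s ())
close-same-parity⇒≡ {suc m} {suc n} (s≤s a) (s≤s b) eq =
  cong suc (close-same-parity⇒≡ a b (not-injective eq))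

-- Co-bipartite graphs from the bits of a colouring.

bit : ∀ c → Fin (2 ^ c) → Fin c → Bool
bit c x i = Inverse.to Fin.2↔Bool (finToFun {2} {c} x i)

funToFin-cong : ∀ {m n} {f g : Fin m → Fin n} → (∀ i → f i ≡ g i) → funToFin f ≡ funToFin g
funToFin-cong {zero}  f≗g = refl
funToFin-cong {suc m} f≗g = cong₂ combine (f≗g zero) (funToFin-cong (f≗g ∘ suc))

bits-injective : ∀ c {x y : Fin (2 ^ c)} → (∀ i → bit c x i ≡ bit c y i) → x ≡ y
bits-injective c {x} {y} same = begin
  x                      ≡⟨ Fin.funToFin-finToFin {c} x ⟨
  funToFin (finToFun {2} {c} x) ≡⟨ funToFin-cong (λ i → Injection.injective (↔⇒↣ Fin.2↔Bool) (same i)) ⟩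
  funToFin (finToFun {2} {c} y) ≡⟨ Fin.funToFin-finToFin {c} y ⟩
  y                      ∎
  where open ≡-Reasoning

module _ {n} (G : Graph n) where

  -- Its complement makes each side a clique and keeps exactly the edges of `G` between the sides.
  nonEdgesAcross : (Fin n → Bool) → Graph n
  nonEdgesAcross side = record
    { Adj         = λ u v → ¬ Adj G u v × side u ≢ side v
    ; symmetric   = λ (¬uv , across) → ¬uv ∘ Graph.symmetric G , across ∘ sym
    ; irreflexive = λ { refl (_ , across) → across refl }
    ; decidable   = λ u v → ¬? (Graph.decidable G u v) ×-dec ¬? (side u Bool.≟ side v)
    }

  sideGraph : (Fin n → Bool) → Graph n
  sideGraph side = complement (nonEdgesAcross side)

  sideGraph-coBipartite : ∀ side → CoBipartite (sideGraph side)
  sideGraph-coBipartite side = nonEdgesAcross side , (side , λ _ _ → proj₂) , λ _ _ → mk⇔ id id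

  edge⇒sideGraph : ∀ side {u v} → Adj G u v → Adj (sideGraph side) u v
  edge⇒sideGraph side uv = (λ u≡v → Graph.irreflexive G u≡v uv) , λ (¬uv , _) → ¬uv uv

  sideGraph⇒same-side : ∀ side {u v} → ¬ Adj G u v → Adj (sideGraph side) u v → side u ≡ side v
  sideGraph⇒same-side side {u} {v} ¬uv (_ , ¬across) =
    decidable-stable (side u Bool.≟ side v) λ across → ¬across (¬uv , across)

  -- Each non-edge of G inside U ∩ C joins two colour classes, so some bit of the
  -- colour separates its ends and the co-bipartite graph of that bit excludes it.
  intersection-of-colour-bits : ∀ c (U C : Graph n) (col : Fin n → Fin (2 ^ c)) →
    UnitInterval U → Chordal C →
    (∀ u v → Adj G u v → Adj U u v) → (∀ u v → Adj G u v → Adj C u v) →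
    (∀ u v → Adj U u v → Adj C u v → col u ≢ col v) →
    Σ[ H ∈ (Fin (c + 2) → Graph n) ]
      (∀ (i : Fin c) → CoBipartite (H (i ↑ˡ 2))) ×
      UnitInterval (H (c ↑ʳ zero)) ×
      Chordal (H (c ↑ʳ suc zero)) ×
      G IsIntersectionOf H
  intersection-of-colour-bits c U C col U-unit C-chordal G⊆U G⊆C proper =
    H , H-coBipartite , subst UnitInterval (sym (H-right zero)) U-unit ,
    subst Chordal (sym (H-right (suc zero))) C-chordal ,
    λ u v → mk⇔ (λ uv i → into (splitAt c i) uv) (λ all → decidable-stable (Graph.decidable G u v) (excluded all))
    where
    side : Fin c → Fin n → Bool
    side i v = bit c (col v) i

    UC : Fin 2 → Graph n
    UC zero    = U
    UC (suc _) = C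

    pick : Fin c ⊎ Fin 2 → Graph n
    pick = [ sideGraph ∘ side , UC ]′

    H : Fin (c + 2) → Graph n
    H i = pick (splitAt c i)

    H-left : ∀ i → H (i ↑ˡ 2) ≡ sideGraph (side i)
    H-left i = cong pick (Fin.splitAt-↑ˡ c i 2)

    H-right : ∀ j → H (c ↑ʳ j) ≡ UC j
    H-right j = cong pick (Fin.splitAt-↑ʳ c 2 j)

    H-coBipartite : ∀ i → CoBipartite (H (i ↑ˡ 2))
    H-coBipartite i = subst CoBipartite (sym (H-left i)) (sideGraph-coBipartite (side i))

    into : ∀ x {u v} → Adj G u v → Adj (pick x) u v
    into (inj₁ i)          = edge⇒sideGraph (side i)
    into (inj₂ zero)       = G⊆U _ _
    into (inj₂ (suc zero)) = G⊆C _ _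

    excluded : ∀ {u v} → (∀ i → Adj (H i) u v) → ¬ ¬ Adj G u v
    excluded {u} {v} all ¬uv = proper u v (at (H-right zero)) (at (H-right (suc zero)))
      (bits-injective c λ i → sideGraph⇒same-side (side i) ¬uv (at (H-left i)))
      where
      at : ∀ {i K} → H i ≡ K → Adj K u v
      at {i} refl = all i

-- Counting and encoding the colours.

colourBits : ℕ → ℕ
colourBits g = ⌊log₂ g ⌋ + 4

colourBits=O : colourBits =O ⌊log₂_⌋
-- From 2 on the logarithm is at least 1, so four times it absorbs the summand 4.
colourBits=O = 5 , 2 , λ m 2≤m → begin
  ⌊log₂ m ⌋ + 4               ≡⟨ +-comm ⌊log₂ m ⌋ 4 ⟩
  4 + ⌊log₂ m ⌋               ≤⟨ +-monoˡ-≤ ⌊log₂ m ⌋ (*-monoʳ-≤ 4 (⌊log₂⌋-mono-≤ 2≤m)) ⟩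
  4 * ⌊log₂ m ⌋ + ⌊log₂ m ⌋   ≡⟨ +-comm (4 * ⌊log₂ m ⌋) _ ⟩
  5 * ⌊log₂ m ⌋               ∎
  where open ≤-Reasoning

n<2^[1+log₂n] : ∀ n → n < 2 ^ suc ⌊log₂ n ⌋
n<2^[1+log₂n] n = ≰⇒> λ 2^≤n → <⇒≱ (n<1+n ⌊log₂ n ⌋)
  (subst (_≤ ⌊log₂ n ⌋) (⌊log₂[2^n]⌋≡n (suc ⌊log₂ n ⌋)) (⌊log₂⌋-mono-≤ 2^≤n))

-- Two ends for each of at most `2 * g` handles, four greedy colours and two parities make at most
-- 8(g + 1) colours. As g + 1 is at most 2 to the power `suc ⌊log₂ g ⌋`, three further bits for the
-- factor 8 suffice, whence the 4 in `colourBits`.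
colours-fit : ∀ g {h} → h ≤ 2 * g → 2 * (h * 2 + 4) ≤ 2 ^ colourBits g
colours-fit g {h} h≤2g = begin
  2 * (h * 2 + 4)         ≤⟨ *-monoʳ-≤ 2 (+-monoˡ-≤ 4 (*-monoˡ-≤ 2 h≤2g)) ⟩
  2 * (2 * g * 2 + 4)     ≡⟨ solve 1 (λ g → con 2 :* (con 2 :* g :* con 2 :+ con 4) := (con 1 :+ g) :* con 8) refl g ⟩
  suc g * 2 ^ 3           ≤⟨ *-monoˡ-≤ (2 ^ 3) (n<2^[1+log₂n] g) ⟩
  2 ^ suc ⌊log₂ g ⌋ * 2 ^ 3 ≡⟨ ^-distribˡ-+-* 2 (suc ⌊log₂ g ⌋) 3 ⟨
  2 ^ (suc ⌊log₂ g ⌋ + 3) ≡⟨ cong (2 ^_) (sym (+-suc ⌊log₂ g ⌋ 3)) ⟩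
  2 ^ colourBits g                 ∎
  where
  open ≤-Reasoning
  open +-*-Solver

encode : ∀ {h k} → Bool × (Dart h ⊎ Fin k) → Fin (2 * (h * 2 + k))
encode {h} {k} (p , m) = combine (from p) (join (h * 2) k (map₁ (λ (i , b) → combine i (from b)) m))
  where
  open Inverse Fin.2↔Bool using (from)

encode-injective : ∀ {h k} → Injective _≡_ _≡_ (encode {h} {k})
encode-injective {h} {k} {p , m} {q , m′} eq
  with p≡q , mm ← Fin.combine-injective _ _ _ _ eq =
  cong₂ _,_ (from-injective p≡q) (marks m m′ (begin
    code m                            ≡⟨ Fin.splitAt-join (h * 2) k (code m) ⟨
    splitAt (h * 2) (join (h * 2) k (code m)) ≡⟨ cong (splitAt (h * 2)) mm ⟩
    splitAt (h * 2) (join (h * 2) k (code m′)) ≡⟨ Fin.splitAt-join (h * 2) k (code m′) ⟩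
    code m′ ∎))
  where
  open ≡-Reasoning
  open Inverse Fin.2↔Bool using (from)
  from-injective : ∀ {x y} → from x ≡ from y → x ≡ y
  from-injective = Injection.injective (↔⇒↣ (↔-sym Fin.2↔Bool))
  code : Dart h ⊎ Fin k → Fin (h * 2) ⊎ Fin k
  code = map₁ (λ (i , b) → combine i (from b))
  marks : ∀ m m′ → code m ≡ code m′ → m ≡ m′
  marks (inj₁ _) (inj₁ _) eq with i≡ , b≡ ← Fin.combine-injective _ _ _ _ (inj₁-injective eq) =
    cong inj₁ (cong₂ _,_ i≡ (from-injective b≡))
  marks (inj₂ _) (inj₂ _) refl = refl

-- Pulling the decomposition back to an embedded graph.

module Embedded {g n} {G : Graph n} (embedding : G EmbedsInGenus g) where
  open _EmbedsInGenus_ embedding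
  open TreeCotree surface
  open BagsOfDarts surface

  level : Fin n → ℕ
  level = T.dist ∘ vertex

  bagGraph : Graph n
  bagGraph = record
    { Adj         = λ u v → u ≢ v × SharesBag (vertex u) (vertex v)
    ; symmetric   = λ (u≢v , d , d∋u , d∋v) → u≢v ∘ sym , d , d∋v , d∋u
    ; irreflexive = λ u≡v (u≢v , _) → u≢v u≡v
    ; decidable   = λ u v → ¬? (u Fin.≟ v) ×-dec anyDart? λ d → bag? d (vertex u) ×-dec bag? d (vertex v)
    }

  bagGraph-chordal : Chordal bagGraph
  bagGraph-chordal = RootedDecomposition.chordal (λ d → Bag d ∘ vertex) parent depth (top ∘ vertex)
    (bag-climbs ∘ vertex) bagGraph (λ _ _ → mk⇔ id id)

  edge⇒≢ : ∀ {u v} → Adj G u v → u ≢ v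
  edge⇒≢ uv u≡v = Graph.irreflexive G u≡v uv

  edge⇒bagGraph : ∀ u v → Adj G u v → Adj bagGraph u v
  edge⇒bagGraph u v uv with d , joins ← edge u v uv = edge⇒≢ uv , d , joined-share-bag joins

  edge⇒level≤ : ∀ u v → Adj G u v → level u ≤ suc (level v)
  edge⇒level≤ u v uv with d , tail , head ← edge u v uv =
    subst₂ (λ x y → T.dist x ≤ suc (T.dist y)) tail head (T.lipschitz d tt)

  edge⇒levelGraph : ∀ u v → Adj G u v → Adj (levelGraph level) u v
  edge⇒levelGraph u v uv =
    edge⇒≢ uv , edge⇒level≤ u v uv , edge⇒level≤ v u (Graph.symmetric G uv)

  colour : Fin n → Fin (2 ^ colourBits g)
  colour v = inject≤ (encode (isOdd (level v) , mark (vertex v))) (colours-fit g handles-bound)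

  colour-proper : ∀ u v → Adj (levelGraph level) u v → Adj bagGraph u v → colour u ≢ colour v
  colour-proper u v (u≢v , u≤ , v≤) (_ , share) same =
    -- Equal parity puts the two neighbouring levels on the same one, where marks separate vertices
    -- that share a bag.
    mark-proper (u≢v ∘ injective) (close-same-parity⇒≡ u≤ v≤ (cong proj₁ codes)) share (cong proj₂ codes)
    where
    codes : (isOdd (level u) , mark (vertex u)) ≡ (isOdd (level v) , mark (vertex v))
    codes = encode-injective (Fin.inject≤-injective _ _ _ _ same)

theorem7 : Σ[ c ∈ (ℕ → ℕ) ]
    c =O ⌊log₂_⌋ ×
    (∀ g n (G : Graph n) → Connected G → G HasGenus g →
    Σ[ H ∈ (Fin (c g + 2) → Graph n) ]
    (∀ (i : Fin (c g)) → CoBipartite (H (i ↑ˡ 2))) ×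
    UnitInterval (H (c g ↑ʳ zero)) ×
    Chordal (H (c g ↑ʳ suc zero)) ×
    G IsIntersectionOf H)
theorem7 = colourBits , colourBits=O , λ g n G _ (embedding , _) →
  let open Embedded embedding in
  intersection-of-colour-bits G (colourBits g) (levelGraph level) bagGraph colour
    (levelGraph-unitInterval level) bagGraph-chordal edge⇒levelGraph edge⇒bagGraph colour-proper
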